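{- Fix an integer $s \ge 4$. Then $r(P_s, t) = \Theta(t^2)$ as $t \to \infty$; that is, there are constants $c_s, C_s > 0$ (depending only on $s$) such that $c_s t^2 \le r(P_s,t) \le C_s t^2$ for all sufficiently large $t$.
   Context: $P_s$ denotes the $3$-uniform tight path: the $3$-uniform hypergraph with vertex set $\{1,\dots,s+2\}$ and edge set $\{\{i,i+1,i+2\} : 1 \le i \le s\}$. For a $3$-uniform hypergraph $F$, the Ramsey number $r(F,t)$ is the smallest $n$ such that every red-blue coloring of the edges of the complete $3$-uniform hypergraph $K_n^{(3)}$ contains a red copy of $F$ or a blue copy of $K_t^{(3)}$. -}

module Defs where

open import Data.Nat using (ℕ; zero; suc; _+_; _*_; _<_; _≤_)
open import Data.Fin as Fin using (Fin; inject₁)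
import Data.Fin
open import Data.Bool using (Bool; true; false)
open import Data.Product using (Σ; _×_)
open import Data.Sum using (_⊎_)
open import Relation.Binary.PropositionalEquality using (_≡_)
open import Relation.Nullary using (¬_)
open import Function.Definitions using (Injective)

-- A red/blue colouring of the edges of the complete 3-uniform hypergraph
-- on vertex set Fin n.  We represent it as a function on ordered triples
-- that is symmetric (invariant under all permutations of its arguments);
-- such functions restricted to triples of distinct vertices correspond
-- exactly to colourings of 3-element subsets.  true = red, false = blue.
record Colouring (n : ℕ) : Set where
  field
    col    : Fin n → Fin n → Fin n → Bool
    sym₁₂  : ∀ x y z → col x y z ≡ col y x z
    sym₂₃  : ∀ x y z → col x y z ≡ col x z y
open Colouring public

red blue : Bool
red  = true
blue = false

RedTightPath : (s : ℕ) {n : ℕ} → Colouring n → Set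
RedTightPath s {n} χ =
  Σ (Fin (2 + s) → Fin n) λ f →
    Injective _≡_ _≡_ f ×
    (∀ (i : Fin s) →
       col χ (f (inject₁ (inject₁ i))) (f (Fin.suc (inject₁ i))) (f (Fin.suc (Fin.suc i))) ≡ red)

BlueClique : (t : ℕ) {n : ℕ} → Colouring n → Set
BlueClique t {n} χ =
  Σ (Fin t → Fin n) λ g →
    Injective _≡_ _≡_ g ×
    (∀ (i j k : Fin t) → i Fin.< j → j Fin.< k → col χ (g i) (g j) (g k) ≡ blue)

Arrows : (n s t : ℕ) → Set
Arrows n s t = (χ : Colouring n) → RedTightPath s χ ⊎ BlueClique t χ

IsRamseyNumber : (s t R : ℕ) → Set
IsRamseyNumber s t R = Arrows R s t × (∀ m → m < R → ¬ Arrows m s t)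

{-# OPTIONS --safe #-}
module Submission where

-- Lower bound: on the grid [m]², colour red the triples {c, y, z} with y to the right of c in
-- its row and z above c in its column.  The pair {y, z} lies in no other red edge, so in a
-- red path v₁ … v₆ the corner of v₂v₃v₄ is v₃ and that of v₃v₄v₅ is v₄; corners have the
-- smallest coordinate sum, a contradiction.  In a set without red edges the points that are
-- not rightmost in their row lie in distinct columns, so it has at most 2m points.
--
-- Upper bound: thin the red 3-graph s − 1 times, each time removing the edges on pairs of
-- codegree at most s + 1.  A surviving edge extends greedily to a red tight path.  If none
-- survives, there are O(n²) red edges, and deleting vertices of maximum degree down to
-- 2t of the n = Ct² vertices leaves at most t edges, hence a blue clique of size t.

open import Defs
open import Algebra.Properties.CommutativeSemigroup using (interchange)
open import Data.Bool using (Bool; true; false; if_then_else_)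
import Data.Bool.Properties as Bool
open import Data.Empty using (⊥-elim)
open import Data.Fin as Fin using (Fin; inject₁; toℕ; finToFun; funToFin; combine; remQuot)
import Data.Fin.Properties as Fin
open import Data.List as List using (List; []; _∷_; _++_; length; map)
open import Data.List.Membership.Propositional using (_∈_; _∉_)
open import Data.List.Membership.Propositional.Properties using (∈-∃++; ∈-lookup)
open import Data.List.Properties using (length-tabulate)
open import Data.List.Relation.Binary.Permutation.Propositional using (_↭_; ↭⇒↭ₛ)
open import Data.List.Relation.Binary.Permutation.Propositional.Properties using (map⁺; shift; ↭-length)
import Data.List.Relation.Binary.Permutation.Setoid.Properties as Permₛ
open import Data.List.Relation.Unary.All as All using (All; []; _∷_)
import Data.List.Relation.Unary.AllPairs as AllPairs
open import Data.List.Relation.Unary.Any using (here; there)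
open import Data.List.Relation.Unary.Unique.Propositional using (Unique; []; _∷_)
import Data.List.Relation.Unary.Unique.Propositional.Properties as Uniqueₚ
open import Data.Nat
open import Data.Nat.ListAction using (sum)
open import Data.Nat.ListAction.Properties using (sum-↭)
open import Data.Nat.Properties
open import Data.Nat.Tactic.RingSolver using (solve-∀)
open import Data.Product using (Σ; ∃; _×_; _,_; proj₁; proj₂; ∃-syntax; uncurry)
open import Data.Sum using (_⊎_; inj₁; inj₂)
import Data.Sum.Properties as Sum
open import Data.Unit using (⊤; tt)
open import Data.Vec as Vec using (Vec; []; _∷_)
open import Data.Vec.Relation.Unary.All as VecAll using ([]; _∷_)
open import Data.Vec.Relation.Unary.AllPairs using ([]; _∷_)
import Data.Vec.Relation.Unary.Unique.Propositional as VecUnique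
open import Data.Vec.Relation.Unary.Unique.Propositional.Properties using (lookup-injective)
open import Function using (_∘_; id; _⇔_; mk⇔; case_of_)
open import Function.Definitions using (Injective)
open import Relation.Binary.Definitions using (DecidableEquality; tri<; tri≈; tri>)
open import Relation.Binary.PropositionalEquality
open import Relation.Nullary using (¬_; Dec; yes; no; does; contradiction)
open import Relation.Nullary.Decidable using (_×-dec_; _⊎-dec_; _→-dec_; ¬?; does-⇔; dec-true; dec-false; map′)
open import Relation.Unary using (Decidable)

-- Sums over lists

module _ {A : Set} where

  ∑ : List A → (A → ℕ) → ℕ
  ∑ xs f = sum (map f xs)

  syntax ∑ xs (λ x → e) = ∑[ x ← xs ] e

  ∑-cong : ∀ xs {f g : A → ℕ} → (∀ x → f x ≡ g x) → ∑ xs f ≡ ∑ xs g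
  ∑-cong []       f≗g = refl
  ∑-cong (x ∷ xs) f≗g = cong₂ _+_ (f≗g x) (∑-cong xs f≗g)

  ∑-mono : ∀ xs {f g : A → ℕ} → (∀ x → f x ≤ g x) → ∑ xs f ≤ ∑ xs g
  ∑-mono []       f≤g = z≤n
  ∑-mono (x ∷ xs) f≤g = +-mono-≤ (f≤g x) (∑-mono xs f≤g)

  ∑-+ : ∀ xs (f g : A → ℕ) → ∑[ x ← xs ] (f x + g x) ≡ ∑ xs f + ∑ xs g
  ∑-+ []       f g = refl
  ∑-+ (x ∷ xs) f g = trans (cong (f x + g x +_) (∑-+ xs f g)) (interchange +-commutativeSemigroup (f x) (g x) (∑ xs f) (∑ xs g))

  ∑-const : ∀ xs c → ∑[ _ ← xs ] c ≡ length xs * c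
  ∑-const []       c = refl
  ∑-const (x ∷ xs) c = cong (c +_) (∑-const xs c)

  ∑-zero : ∀ xs → ∑[ _ ← xs ] 0 ≡ 0
  ∑-zero xs = trans (∑-const xs 0) (*-zeroʳ (length xs))

  ∑-↭ : ∀ {xs ys} (f : A → ℕ) → xs ↭ ys → ∑ xs f ≡ ∑ ys f
  ∑-↭ f p = sum-↭ (map⁺ f p)

  ∈⇒≤∑ : ∀ {xs x} (f : A → ℕ) → x ∈ xs → f x ≤ ∑ xs f
  ∈⇒≤∑ f (here refl) = m≤m+n _ _
  ∈⇒≤∑ f (there x∈)  = m≤n⇒m≤o+n _ (∈⇒≤∑ f x∈)

  ∑>0⇒∃ : ∀ xs (f : A → ℕ) → 0 < ∑ xs f → ∃[ x ] 0 < f x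
  ∑>0⇒∃ (x ∷ xs) f p with f x in eq
  ... | zero  = ∑>0⇒∃ xs f p
  ... | suc _ = x , subst (0 <_) (sym eq) z<s

  ∑-swap : ∀ xs ys (f : A → A → ℕ) → ∑[ x ← xs ] ∑[ y ← ys ] f x y ≡ ∑[ y ← ys ] ∑[ x ← xs ] f x y
  ∑-swap []       ys f = sym (∑-zero ys)
  ∑-swap (x ∷ xs) ys f = trans (cong (∑ ys (f x) +_) (∑-swap xs ys f)) (sym (∑-+ ys (f x) _))

  -- The induction keeps the larger of two values, so the witness is a maximum of `f`, and a maximum
  -- is at least the average.
  ∃-average : ∀ x xs (f : A → ℕ) → ∃[ y ] y ∈ x ∷ xs × ∑ (x ∷ xs) f ≤ length (x ∷ xs) * f y
  ∃-average x []       f = x , here refl , ≤-refl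
  ∃-average x (y ∷ ys) f with ∃-average y ys f
  ... | z , z∈ , ∑≤ with ≤-total (f x) (f z)
  ...   | inj₁ fx≤fz = z , there z∈ , +-mono-≤ fx≤fz ∑≤
  ...   | inj₂ fz≤fx = x , here refl , +-monoʳ-≤ (f x) (≤-trans ∑≤ (*-monoʳ-≤ (suc (length ys)) fz≤fx))

  module _ (_≟ᴬ_ : DecidableEquality A) where

    erase : A → (A → ℕ) → A → ℕ
    erase v f x with x ≟ᴬ v
    ... | yes _ = 0
    ... | no  _ = f x

    erase-≤ : ∀ v f x → erase v f x ≤ f x
    erase-≤ v f x with x ≟ᴬ v
    ... | yes _ = z≤n
    ... | no  _ = ≤-refl

    ∑-erase-∉ : ∀ v f {xs} → All (v ≢_) xs → ∑ xs f ≤ ∑ xs (erase v f)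
    ∑-erase-∉ v f []                = z≤n
    ∑-erase-∉ v f (_∷_ {x} v≢x v∉) with x ≟ᴬ v
    ... | yes x≡v = contradiction (sym x≡v) v≢x
    ... | no  _   = +-monoʳ-≤ (f x) (∑-erase-∉ v f v∉)

    -- A list without repetition meets `v` at most once, and the value lost there is at most 1.
    ∑-erase : ∀ v f → (∀ x → f x ≤ 1) → ∀ {xs} → Unique xs → ∑ xs f ≤ suc (∑ xs (erase v f))
    ∑-erase v f f≤1 []               = z≤n
    ∑-erase v f f≤1 (_∷_ {x} x∉ u) with x ≟ᴬ v
    ... | yes refl = +-mono-≤ (f≤1 x) (∑-erase-∉ v f x∉)
    ... | no  _    = ≤-trans (+-monoʳ-≤ (f x) (∑-erase v f f≤1 u)) (≤-reflexive (+-suc _ _))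

    -- Each forbidden element accounts for at most one unit of the sum. Erasing them one by one
    -- leaves a positive sum, and a point where the erased function is positive is none of them.
    ∃-avoiding : ∀ (vs : List A) f → (∀ x → f x ≤ 1) → ∀ {xs} → Unique xs →
                 length vs < ∑ xs f → ∃[ x ] 0 < f x × x ∉ vs
    ∃-avoiding [] f f≤1 {xs} u p with ∑>0⇒∃ xs f p
    ... | x , fx>0 = x , fx>0 , λ ()
    ∃-avoiding (v ∷ vs) f f≤1 {xs} u p
      with ∃-avoiding vs (erase v f) (λ x → ≤-trans (erase-≤ v f x) (f≤1 x)) u
                      (s<s⁻¹ (<-≤-trans p (∑-erase v f f≤1 u)))
    ... | x , q , x∉ with x ≟ᴬ v
    ...   | yes _  = contradiction q λ ()
    ...   | no x≢v = x , q , λ { (here x≡v) → x≢v x≡v ; (there x∈) → x∉ x∈ }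

  -- Triples are ordered, so for a symmetric 0-1 weight vanishing on repeated vertices this is six
  -- times the number of edges. The factor is carried along rather than divided out.
  ∑³ : List A → (A → A → A → ℕ) → ℕ
  ∑³ xs w = ∑[ x ← xs ] ∑[ y ← xs ] ∑[ z ← xs ] w x y z

  ∑³-↭ : ∀ {xs ys} w → xs ↭ ys → ∑³ xs w ≡ ∑³ ys w
  ∑³-↭ {xs} {ys} w p = trans (∑-↭ _ p) (∑-cong ys λ x →
    trans (∑-↭ _ p) (∑-cong ys λ y → ∑-↭ _ p))

  ∑³-rotate : ∀ xs w → ∑³ xs (λ x y z → w y z x) ≡ ∑³ xs w
  ∑³-rotate xs w = trans (∑-swap xs xs _) (∑-cong xs λ y → ∑-swap xs xs _)

  module _ (w : A → A → A → ℕ)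
           (w-swap₁₂ : ∀ x y z → w x y z ≡ w y x z) (w-swap₂₃ : ∀ x y z → w x y z ≡ w x z y)
           (w-diag : ∀ x y → w x x y ≡ 0) where

    private
      deg : List A → A → ℕ
      deg xs x = ∑[ y ← xs ] ∑[ z ← xs ] w x y z

      w-diag′ : ∀ x y → w x y x ≡ 0
      w-diag′ x y = trans (w-swap₂₃ x y x) (w-diag x y)

    deg-∷ : ∀ x xs → deg (x ∷ xs) x ≡ deg xs x
    deg-∷ x xs = cong₂ _+_
      (trans (∑-cong (x ∷ xs) (w-diag x)) (∑-zero (x ∷ xs)))
      (∑-cong xs λ y → cong (_+ ∑ xs (w x y)) (w-diag′ x y))

    -- The new vertex can stand in any of three positions, each contributing its degree in ordered
    -- pairs. Triples containing it twice have weight zero.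
    ∑³-∷ : ∀ x xs → ∑³ (x ∷ xs) w ≡ ∑³ xs w + 3 * deg xs x
    ∑³-∷ x xs = begin
      deg (x ∷ xs) x + ∑[ a ← xs ] ((w a x x + ∑[ c ← xs ] w a x c) + ∑[ b ← xs ] (w a b x + ∑ xs (w a b)))
        ≡⟨ cong₂ _+_ (deg-∷ x xs) (∑-cong xs step) ⟩
      d + ∑[ a ← xs ] ((∑[ b ← xs ] w x a b) + ((∑[ b ← xs ] w x a b) + ∑[ b ← xs ] ∑ xs (w a b)))
        ≡⟨ cong (d +_) (trans (∑-+ xs _ _) (cong (d +_) (∑-+ xs _ _))) ⟩
      d + (d + (d + ∑³ xs w))
        ≡⟨ arith d (∑³ xs w) ⟩
      ∑³ xs w + 3 * d ∎
      where
      open ≡-Reasoning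
      d = deg xs x
      arith : ∀ d e → d + (d + (d + e)) ≡ e + 3 * d
      arith = solve-∀
      step : ∀ a → (w a x x + ∑[ c ← xs ] w a x c) + ∑[ b ← xs ] (w a b x + ∑ xs (w a b))
                 ≡ (∑[ b ← xs ] w x a b) + ((∑[ b ← xs ] w x a b) + ∑[ b ← xs ] ∑ xs (w a b))
      step a = cong₂ _+_
        (cong₂ _+_ (trans (trans (w-swap₁₂ a x x) (w-swap₂₃ x a x)) (w-diag x a)) (∑-cong xs (w-swap₁₂ a x)))
        (trans (∑-+ xs _ _)
          (cong (_+ ∑[ b ← xs ] ∑ xs (w a b)) (∑-cong xs λ b → trans (w-swap₂₃ a b x) (w-swap₁₂ a x b))))

    -- The degrees add up to `∑³ xs w`, so a vertex of maximum degree has at least the average. Its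
    -- degree `d` is the same before and after its removal, because it is in no edge with itself.
    delete-max : ∀ {m} xs → length xs ≡ suc m → Σ A λ x → Σ (List A) λ ys → Σ ℕ λ d →
                 xs ↭ x ∷ ys × ∑³ xs w ≡ ∑³ ys w + 3 * d × ∑³ xs w ≤ suc m * d
    delete-max (x ∷ xs) refl with ∃-average x xs (deg (x ∷ xs))
    ... | v , v∈ , avg with ∈-∃++ v∈
    ...   | as , bs , eq = v , as ++ bs , deg (as ++ bs) v , p
          , trans (∑³-↭ w p) (∑³-∷ v (as ++ bs))
          , ≤-trans avg (≤-reflexive (cong (length (x ∷ xs) *_) same))
      where
      p : x ∷ xs ↭ v ∷ as ++ bs
      p = subst (_↭ v ∷ as ++ bs) (sym eq) (shift v as bs)
      same : deg (x ∷ xs) v ≡ deg (as ++ bs) v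
      same = trans (trans (∑-↭ _ p) (∑-cong (v ∷ as ++ bs) λ y → ∑-↭ _ p)) (deg-∷ v (as ++ bs))

-- Independent sets and tight paths in 3-graphs with given edge density

module _ {A : Set} where
  cube : ℕ → ℕ
  cube m = m * (m * m)

  UniqueOfLength : ℕ → List A → Set
  UniqueOfLength m xs = Unique xs × length xs ≡ m

  tail-↭ : ∀ {m xs y} {ys : List A} → xs ↭ y ∷ ys → UniqueOfLength (suc m) xs → UniqueOfLength m ys
  tail-↭ p (u , len) = AllPairs.tail (Permₛ.Unique-resp-↭ (setoid A) (↭⇒↭ₛ p) u)
                     , suc-injective (trans (sym (↭-length p)) len)

  -- Removing a vertex of at least average degree leaves e′ ≤ e(1 - 3/(m+1)), and Bernoulli's
  -- inequality bounds the factor by (m/(m+1))³. A common term is added to both sides so that no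
  -- subtraction occurs.
  cube-step : ∀ {m d e e′} → e ≡ e′ + 3 * d → e ≤ suc m * d → e′ * cube (suc m) ≤ e * cube m
  cube-step {m} {d} {e} {e′} e≡ e≤ = +-cancelʳ-≤ (3 * e * (suc m * suc m)) _ _ (begin
      e′ * cube (suc m) + 3 * e * (suc m * suc m)
        ≤⟨ +-monoʳ-≤ (e′ * cube (suc m)) (*-monoˡ-≤ (suc m * suc m) (*-monoʳ-≤ 3 e≤)) ⟩
      e′ * cube (suc m) + 3 * (suc m * d) * (suc m * suc m)
        ≡⟨ arith₁ m d e′ ⟩
      (e′ + 3 * d) * cube (suc m)
        ≡⟨ cong (_* cube (suc m)) (sym e≡) ⟩
      e * cube (suc m)
        -- The slack in Bernoulli's inequality: m³ + 3(m+1)² exceeds (m+1)³ by exactly 3m + 2.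
        ≤⟨ m≤m+n _ (e * (3 * m + 2)) ⟩
      e * cube (suc m) + e * (3 * m + 2)
        ≡⟨ arith₂ m e ⟩
      e * cube m + 3 * e * (suc m * suc m) ∎)
    where
    open ≤-Reasoning
    arith₁ : ∀ m d e′ → e′ * (suc m * (suc m * suc m)) + 3 * (suc m * d) * (suc m * suc m)
                      ≡ (e′ + 3 * d) * (suc m * (suc m * suc m))
    arith₁ = solve-∀
    arith₂ : ∀ m e → e * (suc m * (suc m * suc m)) + e * (3 * m + 2)
                   ≡ e * (m * (m * m)) + 3 * e * (suc m * suc m)
    arith₂ = solve-∀

  module _ (w : A → A → A → ℕ)
           (w-swap₁₂ : ∀ x y z → w x y z ≡ w y x z) (w-swap₂₃ : ∀ x y z → w x y z ≡ w x z y)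
           (w-diag : ∀ x y → w x x y ≡ 0) where

    -- Deleting a vertex of maximum degree keeps (number of edges) / (number of vertices)³ from increasing.
    sparsify : ∀ j {m} K n xs → UniqueOfLength (j + m) xs → ∑³ xs w * n ≤ K * cube (j + m) →
               ∃[ ys ] UniqueOfLength m ys × ∑³ ys w * n ≤ K * cube m
    sparsify zero        K n xs u bound = xs , u , bound
    sparsify (suc j) {m} K n xs u bound with delete-max w w-swap₁₂ w-swap₂₃ w-diag xs (proj₂ u)
    ... | x , ys , d , p , e≡ , e≤ =
      sparsify j K n ys (tail-↭ p u) (*-cancelʳ-≤ _ _ (cube (suc l)) (begin
        e′ * n * cube (suc l)    ≡⟨ arith e′ n (cube (suc l)) ⟩
        n * (e′ * cube (suc l))  ≤⟨ *-monoʳ-≤ n (cube-step {l} {d} {_} {e′} e≡ e≤) ⟩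
        n * (∑³ xs w * cube l)   ≡⟨ sym (arith (∑³ xs w) n (cube l)) ⟩
        ∑³ xs w * n * cube l     ≤⟨ *-monoˡ-≤ (cube l) bound ⟩
        K * cube (suc l) * cube l ≡⟨ arith′ K (cube (suc l)) (cube l) ⟩
        K * cube l * cube (suc l) ∎))
      where
      open ≤-Reasoning
      l = j + m
      e′ = ∑³ ys w
      arith : ∀ a b c → a * b * c ≡ b * (a * c)
      arith = solve-∀
      arith′ : ∀ a b c → a * b * c ≡ a * c * b
      arith′ = solve-∀

    -- As long as edges remain, the vertex deleted has positive degree, so every deletion lowers the
    -- sum and `e` deletions exhaust it.
    clean : ∀ e {m} xs → UniqueOfLength (e + m) xs → ∑³ xs w ≤ e →
            ∃[ ys ] UniqueOfLength m ys × ∑³ ys w ≡ 0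
    clean zero    xs u bound = xs , u , n≤0⇒n≡0 bound
    clean (suc e) xs u bound with delete-max w w-swap₁₂ w-swap₂₃ w-diag xs (proj₂ u)
    -- Maximum degree zero means that no edge is left; deletions continue only to reach length `m`.
    ... | x , ys , zero  , p , e≡ , e≤ = clean e ys (tail-↭ p u) (≤-trans (m≤m+n _ 0) (≤-trans (≤-reflexive (sym e≡))
                                           (≤-trans e≤ (≤-trans (≤-reflexive (*-zeroʳ (suc (e + _)))) z≤n))))
    ... | x , ys , suc d , p , e≡ , e≤ = clean e ys (tail-↭ p u) (s≤s⁻¹ (begin
        suc (∑³ ys w)          ≡⟨ +-comm 1 _ ⟩
        ∑³ ys w + 1            ≤⟨ +-monoʳ-≤ (∑³ ys w) (s≤s z≤n) ⟩
        ∑³ ys w + 3 * suc d    ≡⟨ sym e≡ ⟩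
        ∑³ xs w                ≤⟨ bound ⟩
        suc e                  ∎))
      where open ≤-Reasoning

    -- With n = 8Kt² vertices and sum at most Kn², the ratio of the sum to the cube of the number of
    -- vertices is at most K/n. Keeping this ratio down to 2t vertices leaves a sum of at most
    -- K(2t)³/n = t, and `clean` removes it with t further deletions.
    ∃-independent : ∀ K t .{{_ : NonZero K}} .{{_ : NonZero t}} xs → UniqueOfLength (8 * K * (t * t)) xs →
                    ∑³ xs w ≤ K * (length xs * length xs) →
                    ∃[ ys ] UniqueOfLength t ys × ∑³ ys w ≡ 0
    ∃-independent K t xs (u , len) bound
      with sparsify (n ∸ (t + t)) K n xs (u , trans len (sym split))
             (≤-trans (*-monoˡ-≤ n bound) (≤-reflexive
               (trans (cong (λ l → K * (l * l) * n) len)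
                      (trans (arith₁ K n) (cong (λ l → K * cube l) (sym split))))))
      where
      n = 8 * K * (t * t)
      2t≤n : t + t ≤ n
      2t≤n = begin
        t + t             ≡⟨ cong (t +_) (sym (+-identityʳ t)) ⟩
        2 * t             ≡⟨ cong (2 *_) (sym (*-identityʳ t)) ⟩
        2 * (t * 1)       ≤⟨ *-mono-≤ {2} {8 * K} (≤-trans (m≤n+m 2 6) (m≤m*n 8 K)) (*-monoʳ-≤ t (>-nonZero⁻¹ t)) ⟩
        8 * K * (t * t)   ∎
        where open ≤-Reasoning
      split : n ∸ (t + t) + (t + t) ≡ n
      split = m∸n+n≡m 2t≤n
      arith₁ : ∀ K n → K * (n * n) * n ≡ K * (n * (n * n))
      arith₁ = solve-∀
    ... | ys , v , sparse = clean t ys v (*-cancelʳ-≤ _ _ (8 * K * (t * t)) {{nz}}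
            (≤-trans sparse (≤-reflexive (arith₂ K t))))
      where
      nz : NonZero (8 * K * (t * t))
      nz = m*n≢0 (8 * K) (t * t) {{m*n≢0 8 K}} {{m*n≢0 t t}}
      arith₂ : ∀ K t → K * ((t + t) * ((t + t) * (t + t))) ≡ t * (8 * K * (t * t))
      arith₂ = solve-∀

  -- Thinning by codegree and greedy extension of paths

  module _ (vs : List A) (k : ℕ) where

    -- The cyclic shift of the arguments makes an edge (x, y, z) of thin h continue to many edges (y, z, u) of h.
    thin : (A → A → A → ℕ) → A → A → A → ℕ
    thin h x y z with k <? ∑ vs (h y z)
    ... | yes _ = h y z x
    ... | no  _ = 0

    -- For a 0-1 weight, a triple that survives `j` rounds can be continued `j` times, each time
    -- with more than `k` choices for the next vertex.
    thins : ℕ → (A → A → A → ℕ) → A → A → A → ℕ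
    thins zero    h = h
    thins (suc j) h = thin (thins j h)

    thin>0 : ∀ h {x y z} → 0 < thin h x y z → k < ∑ vs (h y z) × 0 < h y z x
    thin>0 h {x} {y} {z} p with k <? ∑ vs (h y z)
    ... | yes k<d = k<d , p
    ... | no  _   = contradiction p λ ()

    thin≤1 : ∀ h → (∀ x y z → h x y z ≤ 1) → ∀ x y z → thin h x y z ≤ 1
    thin≤1 h h≤1 x y z with k <? ∑ vs (h y z)
    ... | yes _ = h≤1 y z x
    ... | no  _ = z≤n

    thins≤1 : ∀ j {h} → (∀ x y z → h x y z ≤ 1) → ∀ x y z → thins j h x y z ≤ 1
    thins≤1 zero    h≤1 = h≤1
    thins≤1 (suc j) h≤1 = thin≤1 _ (thins≤1 j h≤1)

    -- Each round reads a rotated triple, so rotation invariance of `h` is what brings positivity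
    -- back to the original one.
    thins⇒h : ∀ j {h} → (∀ x y z → h y z x ≡ h x y z) → ∀ {x y z} → 0 < thins j h x y z → 0 < h x y z
    thins⇒h zero    rot p = p
    thins⇒h (suc j) rot p = subst (0 <_) (rot _ _ _) (thins⇒h j rot (proj₂ (thin>0 _ p)))

    -- A pair of codegree above `k` keeps all its edges; any other pair had at most `k` to lose.
    thin-codegree : ∀ h y z → ∑ vs (h y z) ≤ ∑[ x ← vs ] thin h x y z + k
    thin-codegree h y z with k <? ∑ vs (h y z)
    ... | yes _   = m≤m+n _ k
    ... | no k≮d = m≤n⇒m≤o+n _ (≮⇒≥ k≮d)

    -- Summing the loss of at most `k` over all ordered pairs gives the quadratic error term.
    ∑³-thin : ∀ h → ∑³ vs h ≤ ∑³ vs (thin h) + k * (length vs * length vs)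
    ∑³-thin h = begin
      ∑³ vs h
        ≤⟨ ∑-mono vs (λ y → ∑-mono vs (thin-codegree h y)) ⟩
      ∑[ y ← vs ] ∑[ z ← vs ] (∑[ x ← vs ] thin h x y z + k)
        ≡⟨ ∑-cong vs (λ y → trans (∑-+ vs _ _) (cong (∑[ z ← vs ] ∑[ x ← vs ] thin h x y z +_) (∑-const vs k))) ⟩
      ∑[ y ← vs ] (∑[ z ← vs ] ∑[ x ← vs ] thin h x y z + length vs * k)
        ≡⟨ ∑-+ vs _ _ ⟩
      ∑³ vs (λ y z x → thin h x y z) + ∑[ _ ← vs ] (length vs * k)
        -- Two rotations of the summation order bring `x` back to the front.
        ≡⟨ cong₂ _+_ (trans (∑³-rotate vs (λ x y z → thin h y z x)) (∑³-rotate vs (thin h)))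
                     (trans (∑-const vs _) (arith (length vs) k)) ⟩
      ∑³ vs (thin h) + k * (length vs * length vs) ∎
      where
      open ≤-Reasoning
      arith : ∀ l k → l * (l * k) ≡ k * (l * l)
      arith = solve-∀

    ∑³-thins : ∀ j h → ∑³ vs h ≤ ∑³ vs (thins j h) + j * k * (length vs * length vs)
    ∑³-thins zero    h = m≤m+n _ _
    ∑³-thins (suc j) h = begin
      ∑³ vs h                                         ≤⟨ ∑³-thins j h ⟩
      ∑³ vs (thins j h) + j * k * l²                  ≤⟨ +-monoˡ-≤ _ (∑³-thin (thins j h)) ⟩
      ∑³ vs (thins (suc j) h) + k * l² + j * k * l²   ≡⟨ arith (∑³ vs (thins (suc j) h)) k j l² ⟩
      ∑³ vs (thins (suc j) h) + suc j * k * l²        ∎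
      where
      open ≤-Reasoning
      l² = length vs * length vs
      arith : ∀ e k j l → e + k * l + j * k * l ≡ e + suc j * k * l
      arith = solve-∀

  Tight : (A → A → A → ℕ) → A → A → ∀ {j} → Vec A j → Set
  Tight h x y []      = ⊤
  Tight h x y (z ∷ v) = 0 < h x y z × Tight h y z v

  module _ (_≟ᴬ_ : DecidableEquality A) (vs : List A) (unique : Unique vs) (k : ℕ)
           (h : A → A → A → ℕ) (h≤1 : ∀ x y z → h x y z ≤ 1) (h-rotate : ∀ x y z → h y z x ≡ h x y z) where

    -- The pair `y`, `z` has more than `k` continuations that survive the remaining rounds, and at
    -- most `k` vertices are used, so a fresh one exists. The budget is preserved: `used` grows by
    -- one as `j` drops by one.
    extend : ∀ j {x y z} (used : List A) → length used + j ≤ suc k → 0 < thins vs k j h x y z →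
             Σ (Vec A j) λ v → Tight h y z v × VecUnique.Unique v × VecAll.All (_∉ used) v
    extend zero    used fits edge = [] , tt , [] , []
    extend (suc j) {x} {y} {z} used fits edge
      with thin>0 vs k (thins vs k j h) edge
    ... | k<d , _
      with ∃-avoiding _≟ᴬ_ used (thins vs k j h y z) (thins≤1 vs k j h≤1 y z) unique
             (≤-<-trans (≤-trans (m≤m+n (length used) j) (s≤s⁻¹ (≤-trans (≤-reflexive (sym (+-suc _ j))) fits))) k<d)
    ... | u , edge′ , u∉ with extend j (u ∷ used) (≤-trans (≤-reflexive (sym (+-suc _ j))) fits) edge′
    ... | v , tight , uniq , avoid =
      u ∷ v , (thins⇒h vs k j h-rotate edge′ , tight)
            , VecAll.map (λ w∉ u≡w → w∉ (here (sym u≡w))) avoid ∷ uniq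
            , u∉ ∷ VecAll.map (λ w∉ w∈ → w∉ (there w∈)) avoid

-- The upper bound

indicator : {P : Set} → Dec P → ℕ
indicator P? = if does P? then 1 else 0

indicator-≤1 : ∀ {P} (P? : Dec P) → indicator P? ≤ 1
indicator-≤1 (yes _) = s≤s z≤n
indicator-≤1 (no  _) = z≤n

indicator>0 : ∀ {P} (P? : Dec P) → 0 < indicator P? → P
indicator>0 (yes p) _ = p

indicator-⇔ : ∀ {P Q} (P? : Dec P) (Q? : Dec Q) → P ⇔ Q → indicator P? ≡ indicator Q?
indicator-⇔ P? Q? P⇔Q = cong (if_then 1 else 0) (does-⇔ P⇔Q P? Q?)

listLookup-injective : ∀ {A : Set} {xs : List A} → Unique xs → ∀ i j → List.lookup xs i ≡ List.lookup xs j → i ≡ j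
listLookup-injective (_ ∷ _)  Fin.zero    Fin.zero    eq = refl
listLookup-injective (x∉ ∷ _) Fin.zero    (Fin.suc j) eq = contradiction eq (All.lookup x∉ (∈-lookup j))
listLookup-injective (x∉ ∷ _) (Fin.suc i) Fin.zero    eq = contradiction (sym eq) (All.lookup x∉ (∈-lookup i))
listLookup-injective (_ ∷ u)  (Fin.suc i) (Fin.suc j) eq = cong Fin.suc (listLookup-injective u i j eq)

∑³≡0⇒ : ∀ {A : Set} {xs : List A} w → ∑³ xs w ≡ 0 → ∀ {x y z} → x ∈ xs → y ∈ xs → z ∈ xs → w x y z ≡ 0
∑³≡0⇒ {xs = xs} w eq {x} {y} {z} x∈ y∈ z∈ = n≤0⇒n≡0 (begin
  w x y z                                  ≤⟨ ∈⇒≤∑ (w x y) z∈ ⟩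
  ∑ xs (w x y)                             ≤⟨ ∈⇒≤∑ (λ y → ∑ xs (w x y)) y∈ ⟩
  ∑[ y ← xs ] ∑ xs (w x y)                 ≤⟨ ∈⇒≤∑ (λ x → ∑[ y ← xs ] ∑ xs (w x y)) x∈ ⟩
  ∑³ xs w                                  ≡⟨ eq ⟩
  0                                        ∎)
  where open ≤-Reasoning

∑³>0⇒∃ : ∀ {A : Set} (xs : List A) w → 0 < ∑³ xs w → ∃[ x ] ∃[ y ] ∃[ z ] 0 < w x y z
∑³>0⇒∃ xs w p with x , q ← ∑>0⇒∃ xs (λ x → ∑[ y ← xs ] ∑ xs (w x y)) p
              with y , r ← ∑>0⇒∃ xs (λ y → ∑ xs (w x y)) q
              with z , e ← ∑>0⇒∃ xs (w x y) r = x , y , z , e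

module _ {n : ℕ} (χ : Colouring n) where

  -- Distinctness is required explicitly because `col` also takes arbitrary values on triples with
  -- repeated vertices.
  RedEdge : Fin n → Fin n → Fin n → Set
  RedEdge x y z = col χ x y z ≡ red × x ≢ y × y ≢ z × x ≢ z

  redEdge? : ∀ x y z → Dec (RedEdge x y z)
  redEdge? x y z = (col χ x y z Bool.≟ red) ×-dec ¬? (x Fin.≟ y) ×-dec ¬? (y Fin.≟ z) ×-dec ¬? (x Fin.≟ z)

  redEdge-swap₁₂ : ∀ {x y z} → RedEdge x y z → RedEdge y x z
  redEdge-swap₁₂ (r , x≢y , y≢z , x≢z) = trans (sym₁₂ χ _ _ _) r , x≢y ∘ sym , x≢z , y≢z

  redEdge-swap₂₃ : ∀ {x y z} → RedEdge x y z → RedEdge x z y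
  redEdge-swap₂₃ (r , x≢y , y≢z , x≢z) = trans (sym₂₃ χ _ _ _) r , x≢z , y≢z ∘ sym , x≢y

  weight : Fin n → Fin n → Fin n → ℕ
  weight x y z = indicator (redEdge? x y z)

  weight-swap₁₂ : ∀ x y z → weight x y z ≡ weight y x z
  weight-swap₁₂ x y z = indicator-⇔ (redEdge? x y z) (redEdge? y x z) (mk⇔ redEdge-swap₁₂ redEdge-swap₁₂)

  weight-swap₂₃ : ∀ x y z → weight x y z ≡ weight x z y
  weight-swap₂₃ x y z = indicator-⇔ (redEdge? x y z) (redEdge? x z y) (mk⇔ redEdge-swap₂₃ redEdge-swap₂₃)

  weight-rotate : ∀ x y z → weight y z x ≡ weight x y z
  weight-rotate x y z = trans (weight-swap₂₃ y z x) (weight-swap₁₂ y x z)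

  weight-diag : ∀ x y → weight x x y ≡ 0
  weight-diag x y = cong (if_then 1 else 0) (dec-false (redEdge? x x y) λ (_ , x≢x , _) → x≢x refl)

  weight≤1 : ∀ x y z → weight x y z ≤ 1
  weight≤1 x y z = indicator-≤1 (redEdge? x y z)

  weight>0 : ∀ {x y z} → 0 < weight x y z → RedEdge x y z
  weight>0 {x} {y} {z} = indicator>0 (redEdge? x y z)

  tight⇒red : ∀ {j x y} (v : Vec (Fin n) j) → Tight weight x y v → let u = x ∷ y ∷ v in
              ∀ (i : Fin j) → col χ (Vec.lookup u (inject₁ (inject₁ i)))
                                    (Vec.lookup u (Fin.suc (inject₁ i)))
                                    (Vec.lookup u (Fin.suc (Fin.suc i))) ≡ red
  tight⇒red (z ∷ v) (e , _) Fin.zero    = proj₁ (weight>0 e)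
  tight⇒red (z ∷ v) (_ , t) (Fin.suc i) = tight⇒red v t i

  -- The three vertices of the surviving edge and `j` greedy steps give the j + 3 vertices of a path
  -- with j + 1 edges.
  thins>0⇒path : ∀ j → let k = 2 + j in ∀ {x y z} → 0 < thins (List.allFin n) k j weight x y z → RedTightPath (suc j) χ
  thins>0⇒path j {x} {y} {z} edge
    with e ← thins⇒h (List.allFin n) (2 + j) j weight-rotate edge
    with _ , x≢y , y≢z , x≢z ← weight>0 e
    with v , tight , u , avoid ← extend Fin._≟_ (List.allFin n) (Uniqueₚ.allFin⁺ n) (2 + j) weight weight≤1 weight-rotate
                                   -- The threshold k = j + 2 meets the budget with equality: 3 + j
                                   -- = k + 1.
                                   j (x ∷ y ∷ z ∷ []) ≤-refl edge
    = Vec.lookup (x ∷ y ∷ z ∷ v) , (λ {a} {b} → lookup-injective uniq a b) , tight⇒red (z ∷ v) (e , tight)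
    where
    uniq : VecUnique.Unique (x ∷ y ∷ z ∷ v)
    uniq = (x≢y ∷ x≢z ∷ VecAll.map (λ w∉ x≡w → w∉ (here (sym x≡w))) avoid)
         ∷ (y≢z ∷ VecAll.map (λ w∉ y≡w → w∉ (there (here (sym y≡w)))) avoid)
         ∷ VecAll.map (λ w∉ z≡w → w∉ (there (there (here (sym z≡w))))) avoid
         ∷ u

  independent⇒clique : ∀ {t} {xs : List (Fin n)} → UniqueOfLength t xs → ∑³ xs weight ≡ 0 → BlueClique t χ
  independent⇒clique {xs = xs} (u , refl) eq = List.lookup xs , (λ {i} {j} → inj i j) , blue-edge
    where
    inj = listLookup-injective u
    blue-edge : ∀ i j k → i Fin.< j → j Fin.< k → _
    blue-edge i j k i<j j<k = Bool.¬-not λ r → contradiction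
      (trans (sym (cong (if_then 1 else 0) (dec-true (redEdge? _ _ _)
        (r , Fin.<⇒≢ i<j ∘ inj i j , Fin.<⇒≢ j<k ∘ inj j k , Fin.<⇒≢ (Fin.<-trans i<j j<k) ∘ inj i k))))
        (∑³≡0⇒ {xs = xs} weight eq (∈-lookup i) (∈-lookup j) (∈-lookup k))) λ ()

-- A triple surviving all `j` rounds starts a path. If there is none, the rounds have removed
-- everything, at most (2+j)n² each, so the red sum is at most Kn² with K = j(2+j) and
-- `∃-independent` applies.
arrows-quadratic : ∀ j t .{{_ : NonZero j}} .{{_ : NonZero t}} → Arrows (8 * (j * (2 + j)) * (t * t)) (suc j) t
arrows-quadratic j t χ = split _ refl
  where
  k = 2 + j
  vs = List.allFin (8 * (j * k) * (t * t))
  core = ∑³ vs (thins vs k j (weight χ))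
  split : ∀ e → core ≡ e → RedTightPath (suc j) χ ⊎ BlueClique t χ
  split (suc _) core>0
    with _ , _ , _ , edge ← ∑³>0⇒∃ vs (thins vs k j (weight χ)) (subst (0 <_) (sym core>0) z<s)
    = inj₁ (thins>0⇒path χ j edge)
  split zero core≡0
    with S , u , e ← ∃-independent (weight χ) (weight-swap₁₂ χ) (weight-swap₂₃ χ) (weight-diag χ) (j * k) t
                       {{m*n≢0 j k}} vs (Uniqueₚ.allFin⁺ _ , length-tabulate id)
                       (subst (λ e → ∑³ vs (weight χ) ≤ e + j * k * (length vs * length vs)) core≡0
                              (∑³-thins vs k j (weight χ)))
    = inj₂ (independent⇒clique χ u e)

-- The lower bound

does⇒ : ∀ {P : Set} (P? : Dec P) → does P? ≡ true → P
does⇒ (yes p) _ = p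

-- A blue clique speaks only of increasing index triples; adjacent swaps sort any other order.
blue-distinct : ∀ {t n} (χ : Colouring n) (g : Fin t → Fin n) →
  (∀ i j k → i Fin.< j → j Fin.< k → col χ (g i) (g j) (g k) ≡ blue) →
  ∀ i j k → i ≢ j → j ≢ k → i ≢ k → col χ (g i) (g j) (g k) ≡ blue
blue-distinct χ g b i j k i≢j j≢k i≢k with Fin.<-cmp i j | Fin.<-cmp j k | Fin.<-cmp i k
... | tri≈ _ i≡j _ | _ | _ = contradiction i≡j i≢j
... | _ | tri≈ _ j≡k _ | _ = contradiction j≡k j≢k
... | _ | _ | tri≈ _ i≡k _ = contradiction i≡k i≢k
... | tri< p _ _ | tri< q _ _ | _ = b i j k p q
... | tri< _ _ _ | tri> _ _ q | tri< r _ _ = trans (sym₂₃ χ _ _ _) (b i k j r q)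
... | tri< p _ _ | tri> _ _ _ | tri> _ _ r = trans (sym₂₃ χ _ _ _) (trans (sym₁₂ χ _ _ _) (b k i j r p))
... | tri> _ _ p | tri< _ _ _ | tri< r _ _ = trans (sym₁₂ χ _ _ _) (b j i k p r)
... | tri> _ _ _ | tri< q _ _ | tri> _ _ r = trans (sym₁₂ χ _ _ _) (trans (sym₂₃ χ _ _ _) (b j k i q r))
... | tri> _ _ p | tri> _ _ q | _ = trans (sym₂₃ χ _ _ _) (trans (sym₁₂ χ _ _ _) (trans (sym₂₃ χ _ _ _) (b k j i q p)))

-- The vertices are an arbitrary set of points of the m by m grid, so that one construction serves
-- every n ≤ m².
module Grid {n m : ℕ} (row column : Fin n → Fin m)
            (injective : ∀ {x y} → row x ≡ row y → column x ≡ column y → x ≡ y) where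

  Corner : Fin n → Fin n → Fin n → Set
  Corner c y z = (row c ≡ row y × column c Fin.< column y) × (column c ≡ column z × row c Fin.< row z)

  corner? : ∀ c y z → Dec (Corner c y z)
  corner? c y z = ((row c Fin.≟ row y) ×-dec (column c Fin.<? column y))
            ×-dec ((column c Fin.≟ column z) ×-dec (row c Fin.<? row z))

  CornerAt : Fin n → Fin n → Fin n → Set
  CornerAt c y z = Corner c y z ⊎ Corner c z y

  cornerAt-swap : ∀ {c y z} → CornerAt c y z → CornerAt c z y
  cornerAt-swap (inj₁ k) = inj₂ k
  cornerAt-swap (inj₂ k) = inj₁ k

  Edge : Fin n → Fin n → Fin n → Set
  Edge x y z = CornerAt x y z ⊎ CornerAt y x z ⊎ CornerAt z x y

  edge? : ∀ x y z → Dec (Edge x y z)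
  edge? x y z = at? x y z ⊎-dec (at? y x z ⊎-dec at? z x y)
    where
    at? : ∀ c y z → Dec (CornerAt c y z)
    at? c y z = corner? c y z ⊎-dec corner? c z y

  edge-swap₁₂ : ∀ {x y z} → Edge x y z → Edge y x z
  edge-swap₁₂ (inj₁ a)        = inj₂ (inj₁ a)
  edge-swap₁₂ (inj₂ (inj₁ a)) = inj₁ a
  edge-swap₁₂ (inj₂ (inj₂ a)) = inj₂ (inj₂ (cornerAt-swap a))

  edge-swap₂₃ : ∀ {x y z} → Edge x y z → Edge x z y
  edge-swap₂₃ (inj₁ a)        = inj₁ (cornerAt-swap a)
  edge-swap₂₃ (inj₂ (inj₁ a)) = inj₂ (inj₂ a)
  edge-swap₂₃ (inj₂ (inj₂ a)) = inj₂ (inj₁ a)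

  grid : Colouring n
  grid = record
    { col   = λ x y z → does (edge? x y z)
    ; sym₁₂ = λ x y z → does-⇔ (mk⇔ edge-swap₁₂ edge-swap₁₂) (edge? x y z) (edge? y x z)
    ; sym₂₃ = λ x y z → does-⇔ (mk⇔ edge-swap₂₃ edge-swap₂₃) (edge? x y z) (edge? x z y)
    }

  red⇒edge : ∀ {x y z} → col grid x y z ≡ red → Edge x y z
  red⇒edge {x} {y} {z} = does⇒ (edge? x y z)

  height : Fin n → ℕ
  height x = toℕ (row x) + toℕ (column x)

  corner-height : ∀ {c y z} → CornerAt c y z → height c < height y
  corner-height {c} {y} (inj₁ ((r≡ , c<) , _)) = +-mono-≤-< (≤-reflexive (cong toℕ r≡)) c<
  corner-height {c} {y} (inj₂ (_ , (c≡ , r<))) = +-mono-<-≤ r< (≤-reflexive (cong toℕ c≡))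

  -- Both pairs at the corner lie on a grid line; the third pair does not, and it determines the corner.
  opposite-pair : ∀ {c y z x} → Corner c y z → Edge y z x → x ≡ c
  opposite-pair ((rcy , ccy) , (ccz , rcz)) (inj₁ (inj₁ ((ryz , _) , _))) =
    contradiction (trans rcy ryz) (Fin.<⇒≢ rcz)
  opposite-pair ((rcy , ccy) , (ccz , rcz)) (inj₁ (inj₂ (_ , (cyz , _)))) =
    contradiction (trans ccz (sym cyz)) (Fin.<⇒≢ ccy)
  opposite-pair ((rcy , ccy) , (ccz , rcz)) (inj₂ (inj₁ (inj₁ ((rzy , _) , _)))) =
    contradiction (trans rcy (sym rzy)) (Fin.<⇒≢ rcz)
  opposite-pair ((rcy , ccy) , (ccz , rcz)) (inj₂ (inj₁ (inj₂ (_ , (czy , _))))) =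
    contradiction (trans ccz czy) (Fin.<⇒≢ ccy)
  opposite-pair ((rcy , ccy) , (ccz , rcz)) (inj₂ (inj₂ (inj₁ ((rxy , _) , (cxz , _))))) =
    injective (trans rxy (sym rcy)) (trans cxz (sym ccz))
  opposite-pair {c} {y} {z} {x} ((rcy , ccy) , (ccz , rcz)) (inj₂ (inj₂ (inj₂ ((_ , cxz) , (cxy , _))))) =
    contradiction (subst₂ Fin._<_ cxy (sym ccz) cxz) (Fin.<-asym ccy)

  opposite-pair′ : ∀ {c y z x} → CornerAt c y z → Edge y z x → x ≡ c
  opposite-pair′ (inj₁ k) e = opposite-pair k e
  opposite-pair′ (inj₂ k) e = opposite-pair k (edge-swap₁₂ e)

  -- A corner at an end of the middle edge makes the other two vertices an opposite pair, which lies
  -- in no second edge. A corner at v₂ would force v₅ = v₂ in the next edge, and one at v₄ would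
  -- force v₁ = v₄ in the previous edge.
  middle-corner : ∀ {v₁ v₂ v₃ v₄ v₅} → v₁ ≢ v₄ → v₂ ≢ v₅ →
                  Edge v₁ v₂ v₃ → Edge v₂ v₃ v₄ → Edge v₃ v₄ v₅ → CornerAt v₃ v₂ v₄
  middle-corner v₁≢v₄ v₂≢v₅ e₁ (inj₁ a)        e₃ = contradiction (sym (opposite-pair′ a e₃)) v₂≢v₅
  middle-corner v₁≢v₄ v₂≢v₅ e₁ (inj₂ (inj₁ a)) e₃ = a
  middle-corner v₁≢v₄ v₂≢v₅ e₁ (inj₂ (inj₂ a)) e₃ =
    contradiction (opposite-pair′ a (edge-swap₂₃ (edge-swap₁₂ e₁))) v₁≢v₄

  -- The second and third edges both have neighbours on either side, which takes four edges. Their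
  -- corners are the third and fourth vertices, and each would have to be lower than the other.
  no-tight-path : ∀ {s} → ¬ RedTightPath (4 + s) grid
  no-tight-path {s} (f , f-inj , reds) = <-asym (corner-height (cornerAt-swap third)) (corner-height fourth)
    where
    i₀ i₁ i₂ i₃ i₄ i₅ : Fin (6 + s)
    i₀ = Fin.zero
    i₁ = Fin.suc Fin.zero
    i₂ = Fin.suc (Fin.suc Fin.zero)
    i₃ = Fin.suc (Fin.suc (Fin.suc Fin.zero))
    i₄ = Fin.suc (Fin.suc (Fin.suc (Fin.suc Fin.zero)))
    i₅ = Fin.suc (Fin.suc (Fin.suc (Fin.suc (Fin.suc Fin.zero))))
    e₁ : Edge (f i₀) (f i₁) (f i₂)
    e₁ = red⇒edge (reds Fin.zero)
    e₂ : Edge (f i₁) (f i₂) (f i₃)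
    e₂ = red⇒edge (reds (Fin.suc Fin.zero))
    e₃ : Edge (f i₂) (f i₃) (f i₄)
    e₃ = red⇒edge (reds (Fin.suc (Fin.suc Fin.zero)))
    e₄ : Edge (f i₃) (f i₄) (f i₅)
    e₄ = red⇒edge (reds (Fin.suc (Fin.suc (Fin.suc Fin.zero))))
    distinct : ∀ {i j} → i ≢ j → f i ≢ f j
    distinct i≢j = i≢j ∘ f-inj
    third : CornerAt (f i₂) (f i₁) (f i₃)
    third = middle-corner (distinct λ ()) (distinct λ ()) e₁ e₂ e₃
    fourth : CornerAt (f i₃) (f i₂) (f i₄)
    fourth = middle-corner (distinct λ ()) (distinct λ ()) e₂ e₃ e₄

  -- Sets without red edges in the grid

  module _ {t} (g : Fin t → Fin n) where

    private
      RightNeighbour : Fin t → Fin t → Set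
      RightNeighbour i j = row (g i) ≡ row (g j) × column (g i) Fin.< column (g j)

      hasRight? : ∀ i → Dec (∃[ j ] RightNeighbour i j)
      hasRight? i = Fin.any? λ j → (row (g i) Fin.≟ row (g j)) ×-dec (column (g i) Fin.<? column (g j))

    -- Each chosen point is charged to one of the 2m grid lines: to its column if another chosen
    -- point lies to its right, and to its row if it is rightmost there.
    line : Fin t → Fin m ⊎ Fin m
    line i with hasRight? i
    ... | yes _ = inj₂ (column (g i))
    ... | no  _ = inj₁ (row (g i))

    module _ (g-inj : Injective _≡_ _≡_ g)
             (blues : ∀ i j k → i Fin.< j → j Fin.< k → col grid (g i) (g j) (g k) ≡ blue) where

      no-corner : ∀ {i j k} → ¬ Corner (g i) (g j) (g k)
      no-corner {i} {j} {k} c@((r≡ , c<) , (c≡ , r<)) = contradiction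
        (trans (sym (dec-true (edge? (g i) (g j) (g k)) (inj₁ (inj₁ c))))
               (blue-distinct grid g blues i j k
                  (λ i≡j → Fin.<⇒≢ c< (cong (column ∘ g) i≡j))
                  (λ j≡k → Fin.<⇒≢ r< (trans r≡ (cong (row ∘ g) j≡k)))
                  (λ i≡k → Fin.<⇒≢ r< (cong (row ∘ g) i≡k))))
        λ ()

      -- If two points are charged to one column, the one with the smaller row index, its right
      -- neighbour and the other point form a corner. If two are charged to one row, the left one is
      -- not rightmost.
      line-injective : ∀ {i j} → line i ≡ line j → i ≡ j
      line-injective {i} {j} eq with hasRight? i | hasRight? j
      line-injective {i} {j} eq | yes (k , r) | yes (l , q) with Fin.<-cmp (row (g i)) (row (g j))
      ... | tri< p _ _ = ⊥-elim (no-corner {i} {k} {j} (r , (Sum.inj₂-injective eq , p)))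
      ... | tri≈ _ p _ = g-inj (injective p (Sum.inj₂-injective eq))
      ... | tri> _ _ p = ⊥-elim (no-corner {j} {l} {i} (q , (sym (Sum.inj₂-injective eq) , p)))
      line-injective {i} {j} eq | no ¬r | no ¬q with Fin.<-cmp (column (g i)) (column (g j))
      ... | tri< p _ _ = contradiction (j , Sum.inj₁-injective eq , p) ¬r
      ... | tri≈ _ p _ = g-inj (injective (Sum.inj₁-injective eq) p)
      ... | tri> _ _ p = contradiction (i , sym (Sum.inj₁-injective eq) , p) ¬q
      line-injective () | yes _ | no _
      line-injective () | no _ | yes _

      clique-size : t ≤ m + m
      clique-size = ≮⇒≥ λ 2m<t → case Fin.pigeonhole 2m<t (Fin.join m m ∘ line) of λ
        (i , j , i<j , eq) → Fin.<⇒≢ i<j (line-injective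
          (trans (sym (Fin.splitAt-join m m (line i))) (trans (cong (Fin.splitAt m) eq) (Fin.splitAt-join m m (line j)))))

  no-blue-clique : ∀ {t} → m + m < t → ¬ BlueClique t grid
  no-blue-clique 2m<t (g , g-inj , blues) = <⇒≱ 2m<t (clique-size g g-inj blues)

arrows⇒m²<n : ∀ {n m s t} → m + m < t → Arrows n (4 + s) t → m * m < n
arrows⇒m²<n {n} {m} 2m<t arrows = ≰⇒> λ n≤m² →
  let coordinates : Fin n → Fin m × Fin m
      coordinates x = Fin.remQuot {m} m (Fin.inject≤ x n≤m²)
      injective : ∀ {x y} → proj₁ (coordinates x) ≡ proj₁ (coordinates y) →
                  proj₂ (coordinates x) ≡ proj₂ (coordinates y) → x ≡ y
      injective {x} {y} p q = Fin.inject≤-injective n≤m² n≤m² x y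
        (trans (sym (Fin.combine-remQuot {m} m _)) (trans (cong₂ Fin.combine p q) (Fin.combine-remQuot {m} m _)))
      open Grid (proj₁ ∘ coordinates) (proj₂ ∘ coordinates) injective
  in case arrows grid of λ { (inj₁ path) → no-tight-path path ; (inj₂ clique) → no-blue-clique 2m<t clique }

-- Deciding Arrows by enumeration

-- Decoding the code of a function returns it only up to pointwise equality, so enumeration needs
-- predicates that respect this.
Extensional : ∀ {m n} → ((Fin m → Fin n) → Set) → Set
Extensional P = ∀ {f g} → f ≗ g → P f → P g

anyFunction? : ∀ {m n} {P : (Fin m → Fin n) → Set} → Extensional P → Decidable P → Dec (∃ P)
anyFunction? ext P? = map′ (λ (c , p) → finToFun c , p)
                           (λ (f , p) → funToFin f , ext (sym ∘ Fin.finToFun-funToFin f) p)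
                           (Fin.any? (P? ∘ finToFun))

allFunctions? : ∀ {m n} {P : (Fin m → Fin n) → Set} → Extensional P → Decidable P → Dec (∀ f → P f)
allFunctions? ext P? = map′ (λ all f → ext (Fin.finToFun-funToFin f) (all (funToFin f)))
                            (λ all c → all (finToFun c))
                            (Fin.all? (P? ∘ finToFun))

injective? : ∀ {m n} (f : Fin m → Fin n) → Dec (Injective _≡_ _≡_ f)
injective? f = map′ (λ inj {i} {j} → inj i j) (λ inj i j → inj {i} {j})
                    (Fin.all? λ i → Fin.all? λ j → (f i Fin.≟ f j) →-dec (i Fin.≟ j))

injective-ext : ∀ {m n} → Extensional {m} {n} (Injective _≡_ _≡_)
injective-ext f≗g inj {i} {j} eq = inj (trans (f≗g i) (trans eq (sym (f≗g j))))

cong₃ : ∀ {A B : Set} (h : A → A → A → B) {x x′ y y′ z z′} → x ≡ x′ → y ≡ y′ → z ≡ z′ → h x y z ≡ h x′ y′ z′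
cong₃ h refl refl refl = refl

redTightPath? : ∀ s {n} (χ : Colouring n) → Dec (RedTightPath s χ)
redTightPath? s χ = anyFunction?
  (λ f≗g (inj , reds) → injective-ext f≗g inj ,
    λ i → trans (cong₃ (col χ) (sym (f≗g _)) (sym (f≗g _)) (sym (f≗g _))) (reds i))
  (λ f → injective? f ×-dec Fin.all? λ i → _ Bool.≟ red)

blueClique? : ∀ t {n} (χ : Colouring n) → Dec (BlueClique t χ)
blueClique? t χ = anyFunction?
  (λ f≗g (inj , blues) → injective-ext f≗g inj ,
    λ i j k i<j j<k → trans (cong₃ (col χ) (sym (f≗g _)) (sym (f≗g _)) (sym (f≗g _))) (blues i j k i<j j<k))
  (λ f → injective? f ×-dec Fin.all? λ i → Fin.all? λ j → Fin.all? λ k →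
    (i Fin.<? j) →-dec ((j Fin.<? k) →-dec (_ Bool.≟ blue)))

Monochromatic : ∀ s t {n} → Colouring n → Set
Monochromatic s t χ = RedTightPath s χ ⊎ BlueClique t χ

monochromatic-ext : ∀ {s t n} (χ ψ : Colouring n) → (∀ x y z → col χ x y z ≡ col ψ x y z) →
                    Monochromatic s t χ → Monochromatic s t ψ
monochromatic-ext χ ψ χ≗ψ (inj₁ (f , inj , reds))  = inj₁ (f , inj , λ i → trans (sym (χ≗ψ _ _ _)) (reds i))
monochromatic-ext χ ψ χ≗ψ (inj₂ (g , inj , blues)) =
  inj₂ (g , inj , λ i j k i<j j<k → trans (sym (χ≗ψ _ _ _)) (blues i j k i<j j<k))

-- Colourings coded as functions between finite sets

module _ (n : ℕ) where

  Code : Set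
  Code = Fin (n * (n * n)) → Fin 2

  bool : Fin 2 → Bool
  bool Fin.zero    = false
  bool (Fin.suc _) = true

  bit : Bool → Fin 2
  bit false = Fin.zero
  bit true  = Fin.suc Fin.zero

  bool-bit : ∀ b → bool (bit b) ≡ b
  bool-bit false = refl
  bool-bit true  = refl

  decode : Code → Fin n → Fin n → Fin n → Bool
  decode c x y z = bool (c (combine x (combine y z)))

  encode : (Fin n → Fin n → Fin n → Bool) → Code
  encode h i = bit (uncurry (λ x → uncurry (h x) ∘ remQuot {n} n) (remQuot {n} (n * n) i))

  decode-encode : ∀ h x y z → decode (encode h) x y z ≡ h x y z
  decode-encode h x y z = begin
    bool (encode h (combine x (combine y z)))
      ≡⟨ cong (bool ∘ bit ∘ uncurry λ a → uncurry (h a) ∘ remQuot {n} n) (Fin.remQuot-combine x (combine y z)) ⟩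
    bool (bit (uncurry (h x) (remQuot {n} n (combine y z))))
      ≡⟨ bool-bit _ ⟩
    uncurry (h x) (remQuot {n} n (combine y z))
      ≡⟨ cong (uncurry (h x)) (Fin.remQuot-combine y z) ⟩
    h x y z ∎
    where open ≡-Reasoning

  Symmetric : Code → Set
  Symmetric c = (∀ x y z → decode c x y z ≡ decode c y x z) × (∀ x y z → decode c x y z ≡ decode c x z y)

  symmetric? : ∀ c → Dec (Symmetric c)
  symmetric? c = (Fin.all? λ x → Fin.all? λ y → Fin.all? λ z → decode c x y z Bool.≟ decode c y x z)
           ×-dec (Fin.all? λ x → Fin.all? λ y → Fin.all? λ z → decode c x y z Bool.≟ decode c x z y)

  colouring : ∀ c → Symmetric c → Colouring n
  colouring c (s₁ , s₂) = record { col = decode c ; sym₁₂ = s₁ ; sym₂₃ = s₂ }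

  decode-cong : ∀ {c d : Code} → c ≗ d → ∀ x y z → decode c x y z ≡ decode d x y z
  decode-cong c≗d x y z = cong bool (c≗d _)

  symmetric-ext : Extensional Symmetric
  symmetric-ext c≗d (s₁ , s₂) =
      (λ x y z → trans (sym (decode-cong c≗d x y z)) (trans (s₁ x y z) (decode-cong c≗d y x z)))
    , (λ x y z → trans (sym (decode-cong c≗d x y z)) (trans (s₂ x y z) (decode-cong c≗d x z y)))

  arrows? : ∀ s t → Dec (Arrows n s t)
  arrows? s t = map′ to from (allFunctions? (λ {c} {d} → ext {c} {d}) dec)
    where
    P : Code → Set
    -- Quantifying over symmetry proofs defines `P` on every code; codes that are not symmetric
    -- satisfy it vacuously.
    P c = ∀ σ → Monochromatic s t (colouring c σ)
    ext : Extensional P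
    ext {c} {d} c≗d p σ = monochromatic-ext (colouring c (symmetric-ext (sym ∘ c≗d) σ)) (colouring d σ) (decode-cong c≗d) (p (symmetric-ext (sym ∘ c≗d) σ))
    dec : Decidable P
    dec c with symmetric? c
    ... | no ¬σ = yes λ σ → contradiction σ ¬σ
    ... | yes σ = map′ (λ p σ′ → monochromatic-ext (colouring c σ) (colouring c σ′) (λ _ _ _ → refl) p) (λ p → p σ)
                       (redTightPath? s (colouring c σ) ⊎-dec blueClique? t (colouring c σ))
    to : (∀ c → P c) → Arrows n s t
    to p χ = monochromatic-ext (colouring (encode (col χ)) σ) χ (decode-encode (col χ)) (p (encode (col χ)) σ)
      where
      σ : Symmetric (encode (col χ))
      σ = (λ x y z → trans (decode-encode (col χ) x y z) (trans (sym₁₂ χ x y z) (sym (decode-encode (col χ) y x z))))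
        , (λ x y z → trans (decode-encode (col χ) x y z) (trans (sym₂₃ χ x y z) (sym (decode-encode (col χ) x z y))))
    from : Arrows n s t → ∀ c → P c
    from arrows c σ = arrows (colouring c σ)

least : ∀ {P : ℕ → Set} → Decidable P → ∀ n → P n →
        Σ ℕ λ m → P m × (∀ k → k < m → ¬ P k) × m ≤ n
least P? zero    p = zero , p , (λ _ ()) , z≤n
least {P} P? (suc n) p with P? 0
... | yes p₀ = zero , p₀ , (λ _ ()) , z≤n
... | no ¬p₀ with least (P? ∘ suc) n p
...   | m , pm , below , m≤n = suc m , pm , (λ { zero _ → ¬p₀ ; (suc k) k<m → below k (s<s⁻¹ k<m) }) , s≤s m≤n

-- The Ramsey number

-- Decidability of `Arrows` makes the search for the least such number constructive, so one arrowing
-- `n` gives both existence and the bound.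
ramseyNumber≤ : ∀ {n s t} → Arrows n s t → Σ ℕ λ R → IsRamseyNumber s t R × R ≤ n
ramseyNumber≤ {n} {s} {t} arrows = pack (least {λ n → Arrows n s t} (λ n → arrows? n s t) n arrows)
  where
  pack : (Σ ℕ λ R → Arrows R s t × (∀ m → m < R → ¬ Arrows m s t) × R ≤ n) →
         Σ ℕ λ R → IsRamseyNumber s t R × R ≤ n
  pack (R , a , below , R≤n) = R , (a , below) , R≤n

-- This supplies the side `m` of the grid: m + m ≤ t excludes blue cliques of size t + 1, while t ≤
-- 2m + 1 keeps m² of order t².
half : ∀ t → ∃[ m ] m + m ≤ t × t ≤ suc (m + m)
half zero    = 0 , z≤n , z≤n
half (suc zero) = 0 , z≤n , ≤-refl
half (suc (suc t)) with m , lo , hi ← half t =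
  suc m , s≤s (≤-trans (≤-reflexive (+-suc m m)) (s≤s lo))
        , s≤s (s≤s (≤-trans hi (≤-reflexive (sym (+-suc m m)))))

m≤m² : ∀ m → m ≤ m * m
m≤m² zero    = z≤n
m≤m² (suc m) = m≤m*n (suc m) (suc m)

-- Since t + 1 ≤ 2m + 2, the square is at most 4m² + 8m + 4. Replacing 8m by 8m² gives 12m² + 4,
-- which is within 16(m² + 1) ≤ 16R.
square-bound : ∀ {t m R} → t ≤ suc (m + m) → m * m < R → suc t * suc t ≤ 16 * R
square-bound {t} {m} {R} t≤ m²<R = begin
  suc t * suc t                         ≤⟨ *-mono-≤ (s≤s t≤) (s≤s t≤) ⟩
  (2 + (m + m)) * (2 + (m + m))         ≡⟨ arith₁ m ⟩
  4 * (m * m) + 8 * m + 4               ≤⟨ +-monoˡ-≤ 4 (+-monoʳ-≤ (4 * (m * m)) (*-monoʳ-≤ 8 (m≤m² m))) ⟩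
  4 * (m * m) + 8 * (m * m) + 4         ≤⟨ m≤m+n _ (4 * (m * m) + 12) ⟩
  4 * (m * m) + 8 * (m * m) + 4 + (4 * (m * m) + 12) ≡⟨ arith₂ (m * m) ⟩
  16 * suc (m * m)                      ≤⟨ *-monoʳ-≤ 16 m²<R ⟩
  16 * R ∎
  where
  open ≤-Reasoning
  arith₁ : ∀ m → (2 + (m + m)) * (2 + (m + m)) ≡ 4 * (m * m) + 8 * m + 4
  arith₁ = solve-∀
  arith₂ : ∀ q → 4 * q + 8 * q + 4 + (4 * q + 12) ≡ 16 * suc q
  arith₂ = solve-∀

mainTheorem2 : (s : ℕ) → s ≥ 4 →
    Σ ℕ λ d → Σ ℕ λ C → Σ ℕ λ t₀ →
    (0 < d) × (0 < C) ×
    ((t : ℕ) → t ≥ t₀ →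
    Σ ℕ λ R → IsRamseyNumber s t R × (t * t ≤ d * R) × (R ≤ C * (t * t)))
mainTheorem2 (suc (suc (suc (suc s)))) (s≤s (s≤s (s≤s (s≤s z≤n)))) =
  16 , 8 * (j * (2 + j)) , 1 , z<s , z<s , bounds
  where
  -- Here `s` is the original parameter less four, so `suc j` is the number of edges of the path and
  -- `j` the number of thinning rounds.
  j = 3 + s
  bounds : (t : ℕ) → t ≥ 1 → Σ ℕ λ R →
           IsRamseyNumber (suc j) t R × (t * t ≤ 16 * R) × (R ≤ 8 * (j * (2 + j)) * (t * t))
  bounds (suc t) _ = conclude (half t) (ramseyNumber≤ (arrows-quadratic j (suc t)))
    where
    conclude : (∃[ m ] m + m ≤ t × t ≤ suc (m + m)) →
               (Σ ℕ λ R → IsRamseyNumber (suc j) (suc t) R × R ≤ 8 * (j * (2 + j)) * (suc t * suc t)) → _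
    conclude (m , 2m≤t , t≤) (R , ramsey , R≤) =
      R , ramsey , square-bound {m = m} t≤ (arrows⇒m²<n {m = m} (s≤s 2m≤t) (proj₁ ramsey)) , R≤
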